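{- Let $n\ge 1$ and $k\ge 0$ be integers and let $\alpha=(a_1,\ldots,a_n)\in PP_n$. Then $\alpha\in PF_{n,k}$ if and only if, for every maximal interval $[p,q]\subseteq U_\alpha$, there exists $J\subseteq[n]$ such that $a_j\in[p,\,p-2+|J|]$ for all $j\in J$, and $\tau_{p-2}(\alpha_{|_J})\in PF_{|J|,k}$ is a complete $k$-Naples parking function (i.e. it is a complete parking preference of length $|J|$ that belongs to $PF_{|J|,k}$).
   Context: For integers $a\le b$, $[a,b]=\{a,a+1,\ldots,b\}$ (empty if $a>b$) and $[n]=[1,n]$. A parking preference of length $n$ is a tuple $\alpha=(a_1,\ldots,a_n)$ with entries in $[n]$; $PP_n$ is the set of these. Cars $c_1,\ldots,c_n$ arrive in this order at a one-way street with spots $1,\ldots,n$, and $a_i$ is the preferred spot of $c_i$. $k$-Naples parking rule: car $c_i$ parks in spot $a_i$ if it is free; otherwise it checks one at a time the spots $a_i-1,a_i-2,\ldots,a_i-k$ (only those that are $\ge 1$), parking in the first free one found; if none is free, it proceeds forward and parks in the first free spot $>a_i$, if any; otherwise it fails to park. $PF_{n,k}$, the set of $k$-Naples parking functions of length $n$, is the set of $\alpha\in PP_n$ for which all cars park under this rule. $|\alpha|_i$ is the number of indices $h$ with $a_h=i$. The excess function is $u_\alpha(j)=\sum_{i=j}^n|\alpha|_i-(n-j+1)$ for $j\in[n]$, and $U_\alpha=\{j\in[n] : u_\alpha(j)\ge 1\}$ (note $1\notin U_\alpha$). A maximal interval $[p,q]\subseteq U_\alpha$ is a nonempty interval of consecutive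 integers contained in $U_\alpha$ that is maximal under inclusion. For $n\ge 2$, $\alpha\in PP_n$ is complete if $U_\alpha=[2,n]$ (completeness is only defined for length at least $2$). For $w\in\mathbb Z$ the $w$-shift of a tuple $(b_1,\ldots,b_h)$ is $\tau_w(b_1,\ldots,b_h)=(b_1-w,\ldots,b_h-w)$. For $J=\{j_1<\cdots<j_h\}\subseteq[n]$, the restriction is $\alpha_{|_J}=(a_{j_1},\ldots,a_{j_h})$. -}

module Defs where

open import Data.Fin.Subset using (Subset; inside; outside; ∣_∣)
open import Data.Integer.Base as ℤ using (ℤ; +_; _⊖_)
open import Data.List.Base using (List; []; _∷_; _++_; applyUpTo; find)
open import Data.List.Membership.DecPropositional using () renaming (_∈?_ to member?)
open import Data.Maybe.Base using (Maybe; just)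
open import Data.Nat.Base using (ℕ; zero; suc; _+_; _∸_; _≤_)
open import Data.Nat.ListAction using (sum)
open import Data.Nat.Properties using (_≟_)
open import Data.Product.Base using (_×_; ∃)
open import Data.Unit.Base using (⊤)
open import Data.Vec.Base using (Vec; []; _∷_; count; map)
open import Data.Vec.Relation.Unary.All using (All)
open import Level using (0ℓ)
open import Relation.Binary.PropositionalEquality.Core using (_≡_)
open import Relation.Nullary.Decidable.Core using (¬?)
open import Relation.Unary using (Pred; _∈_; _⊆_; _≐_)

[_,_] : ℕ → ℕ → Pred ℕ 0ℓ
[ a , b ] x = a ≤ x × x ≤ b

Σ[_,_] : ℕ → ℕ → (ℕ → ℕ) → ℕ
Σ[ a , b ] f = sum (applyUpTo (λ i → f (a + i)) (suc b ∸ a))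

PP : ∀ {n} → Vec ℕ n → Set
PP {n} α = All [ 1 , n ] α

-- The spots a - 1, a - 2, …, a - k, in this order, stopping at spot 1.
backward : ℕ → ℕ → List ℕ
backward (suc k) (suc (suc a)) = suc a ∷ backward k (suc a)
backward _       _             = []

-- The spots a + 1, …, n, in this order.
forward : ℕ → ℕ → List ℕ
forward n a = applyUpTo (λ i → suc a + i) (n ∸ a)

-- All the spots a car preferring spot a may park in, in the order in
-- which it considers them.
route : (n k a : ℕ) → List ℕ
route n k a = a ∷ backward k a ++ forward n a

-- The spot taken by a car preferring spot a when the spots in occ are
-- occupied, if any.
park : (n k : ℕ) (occ : List ℕ) (a : ℕ) → Maybe ℕ
park n k occ a = find (λ s → ¬? (member? _≟_ s occ)) (route n k a)

-- Here n is the number of spots, while m is the number of cars that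
-- have not arrived yet.
AllPark : (n k : ℕ) (occ : List ℕ) → ∀ {m} → Vec ℕ m → Set
AllPark n k occ []      = ⊤
AllPark n k occ (a ∷ α) =
  ∃ λ s → park n k occ a ≡ just s × AllPark n k (s ∷ occ) α

PF : (k : ℕ) → ∀ {n} → Vec ℕ n → Set
PF k {n} α = PP α × AllPark n k [] α

occurrences : ∀ {n} → Vec ℕ n → ℕ → ℕ
occurrences α i = count (_≟ i) α

-- Only used for j in [ 1 , n ], where suc n ∸ j is n - j + 1.
excess : ∀ {n} → Vec ℕ n → ℕ → ℤ
excess {n} α j = Σ[ j , n ] (occurrences α) ⊖ (suc n ∸ j)

U : ∀ {n} → Vec ℕ n → Pred ℕ 0ℓ
U {n} α j = j ∈ [ 1 , n ] × + 1 ℤ.≤ excess α j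

record MaximalInterval (p q : ℕ) (S : Pred ℕ 0ℓ) : Set where
  field
    nonempty : p ≤ q
    included : [ p , q ] ⊆ S
    maximal  : ∀ p′ q′ → [ p , q ] ⊆ [ p′ , q′ ] → [ p′ , q′ ] ⊆ S →
               [ p′ , q′ ] ⊆ [ p , q ]

record Complete {n : ℕ} (α : Vec ℕ n) : Set where
  field
    length≥2   : 2 ≤ n
    preference : PP α
    U≐[2,n]    : U α ≐ [ 2 , n ]

-- The w-shift, for w ≥ 0 and tuples whose entries are all at least w;
-- on these the truncated subtraction is exact.  It is applied with
-- w = p - 2, for [ p , q ] a maximal interval of U α (so p ≥ 2, as
-- 1 ∉ U α), to tuples whose entries are all at least p.
τ : ℕ → ∀ {h} → Vec ℕ h → Vec ℕ h
τ w = map (_∸ w)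

restrict : ∀ {n} → Vec ℕ n → (J : Subset n) → Vec ℕ ∣ J ∣
restrict []      []            = []
restrict (a ∷ α) (inside  ∷ J) = a ∷ restrict α J
restrict (a ∷ α) (outside ∷ J) = restrict α J

{-# OPTIONS --safe #-}
module Submission where

-- On a street without right end every car parks, and α is parking iff no car
-- ends beyond n.  A car moving forward to s leaves all the spots from k before
-- its preference up to s full, so no car ever passes over s backward, whether
-- before or after it (no-crossing).
--
-- (⇒) Let p ∈ U α, p - 1 ∉ U α.  By counting, some car crosses backward from
-- p to p - 1, so spot p - 1 is taken by such a car.  Let d be the last
-- spot such that each edge (j - 1, j) with p ≤ j ≤ d is crossed backward by a
-- car parking at p - 1 or beyond.  The cars parked in [p - 1, d] form J: no
-- edge inside this block is crossed forward, and each is crossed backward.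
--
-- (⇐) If some car ends beyond n, let f be the last free spot of [n].  Then
-- f + 1 ∈ U α, and f lies in the block of the set J given for the interval
-- around f + 1.  When J parks alone, some car crosses f + 1 backward, so f is
-- taken by a car not coming from the left.  The spots it finds full are also
-- full when all cars park, so it would take f there too.

open import Defs
open import Data.Empty using (⊥)
open import Data.Fin.Base using (Fin; zero; suc)
open import Data.Fin.Properties using (any?)
open import Data.Fin.Subset using (Subset; ∣_∣; inside; outside) renaming (_∈_ to _∈ˢ_)
open import Data.Fin.Subset.Properties using (drop-there)
import Data.Integer.Base as ℤ
open import Data.Integer.Base using (_⊖_)
import Data.Integer.Properties as ℤ
open import Data.List.Base using (List; []; _∷_; _++_; applyUpTo; find)
open import Data.List.Membership.Propositional using () renaming (_∈_ to _∈ₗ_; _∉_ to _∉ₗ_)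
open import Data.List.Membership.Propositional.Properties using (∈-applyUpTo⁺; ∈-++⁺ˡ; ∈-++⁺ʳ)
open import Data.List.Membership.DecPropositional using () renaming (_∈?_ to member?)
open import Data.List.Relation.Unary.Any using (here; there)
open import Data.Maybe.Base using (just; nothing)
open import Data.Nat.Base using (ℕ; zero; suc; _+_; _∸_; _≤_; _<_; z≤n; s≤s; z<s; s≤s⁻¹)
open import Data.Nat.ListAction using (sum)
open import Data.Nat.Properties
open import Data.Product.Base using (_×_; ∃; _,_; proj₁; proj₂)
open import Data.Sum.Base using (_⊎_; inj₁; inj₂; [_,_]′)
open import Data.Vec.Base using (Vec; []; _∷_; here; there; lookup; count; map)
open import Data.Vec.Properties using (count≤n; lookup-map)
open import Data.Vec.Relation.Unary.All as All using (All; []; _∷_)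
open import Data.Vec.Relation.Unary.All.Properties using (lookup⁺; lookup⁻)
open import Function.Base using (_∘_; id)
open import Function.Bundles using (_⇔_; mk⇔)
open import Relation.Binary.PropositionalEquality using (_≡_; _≢_; refl; sym; trans; cong; subst; module ≡-Reasoning)
open import Relation.Binary.Definitions using (tri<; tri≈; tri>)
open import Relation.Nullary using (¬_; yes; no; contradiction; Dec)
open import Relation.Nullary.Decidable using (¬?; _×-dec_)
open import Relation.Unary using (_∈_; Decidable)

-- Counting

module _ {A : Set} {P : A → Set} (P? : Decidable P) where

  count-yes : ∀ {n x} {v : Vec A n} → P x → count P? (x ∷ v) ≡ suc (count P? v)
  count-yes {x = x} px with P? x
  ... | yes _  = refl
  ... | no ¬px = contradiction px ¬px

  count-no : ∀ {n x} {v : Vec A n} → ¬ P x → count P? (x ∷ v) ≡ count P? v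
  count-no {x = x} ¬px with P? x
  ... | yes px = contradiction px ¬px
  ... | no _   = refl

  count-∷ˡ : ∀ {n} x (v : Vec A n) → count P? v ≤ count P? (x ∷ v)
  count-∷ˡ x v with P? x
  ... | yes _ = n≤1+n _
  ... | no _  = ≤-refl

  count-∷ʳ : ∀ {n} x (v : Vec A n) → count P? (x ∷ v) ≤ suc (count P? v)
  count-∷ʳ x v with P? x
  ... | yes _ = ≤-refl
  ... | no _  = n≤1+n _

  count>0 : ∀ {n} (v : Vec A n) → 0 < count P? v → ∃ λ i → P (lookup v i)
  count>0 (x ∷ v) 0<c with P? x
  ... | yes px = zero , px
  ... | no _   with i , pi ← count>0 v 0<c = suc i , pi

  count-positive : ∀ {n} (v : Vec A n) i → P (lookup v i) → 0 < count P? v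
  count-positive (x ∷ v) zero    px rewrite count-yes {v = v} px = z<s
  count-positive (x ∷ v) (suc i) pi = ≤-trans (count-positive v i pi) (count-∷ˡ x v)

  count≡n : ∀ {n} (v : Vec A n) → (∀ i → P (lookup v i)) → count P? v ≡ n
  count≡n []      all = refl
  count≡n (x ∷ v) all =
    trans (count-yes {v = v} (all zero)) (cong suc (count≡n v (all ∘ suc)))

  count≡0 : ∀ {n} (v : Vec A n) → (∀ i → ¬ P (lookup v i)) → count P? v ≡ 0
  count≡0 []      none = refl
  count≡0 (x ∷ v) none = trans (count-no {v = v} (none zero)) (count≡0 v (none ∘ suc))

module _ {A B : Set} {P : A → Set} {Q : B → Set}
         (P? : Decidable P) (Q? : Decidable Q) where

  count-mono : ∀ {n} (v : Vec A n) (w : Vec B n) →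
    (∀ i → P (lookup v i) → Q (lookup w i)) → count P? v ≤ count Q? w
  count-mono []      []      P⇒Q = z≤n
  count-mono (x ∷ v) (y ∷ w) P⇒Q with P? x | Q? y
  ... | yes _  | yes _  = s≤s (count-mono v w (P⇒Q ∘ suc))
  ... | yes px | no ¬qy = contradiction (P⇒Q zero px) ¬qy
  ... | no _   | yes _  = m≤n⇒m≤1+n (count-mono v w (P⇒Q ∘ suc))
  ... | no _   | no _   = count-mono v w (P⇒Q ∘ suc)

  count-mono-< : ∀ {n} (v : Vec A n) (w : Vec B n) →
    (∀ i → P (lookup v i) → Q (lookup w i)) →
    ∀ i → ¬ P (lookup v i) → Q (lookup w i) → count P? v < count Q? w
  count-mono-< (x ∷ v) (y ∷ w) P⇒Q zero ¬p q
    rewrite count-no P? {v = v} ¬p | count-yes Q? {v = w} q =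
    s≤s (count-mono v w (P⇒Q ∘ suc))
  count-mono-< (x ∷ v) (y ∷ w) P⇒Q (suc i) ¬p q with P? x | Q? y
  ... | yes _  | yes _  = s≤s (count-mono-< v w (P⇒Q ∘ suc) i ¬p q)
  ... | yes px | no ¬qy = contradiction (P⇒Q zero px) ¬qy
  ... | no _   | yes _  = m≤n⇒m≤1+n (count-mono-< v w (P⇒Q ∘ suc) i ¬p q)
  ... | no _   | no _   = count-mono-< v w (P⇒Q ∘ suc) i ¬p q

-- Tail counts and the excess function

atLeast : ℕ → ∀ {n} → Vec ℕ n → ℕ
atLeast j = count (j ≤?_)

atLeast-step : ∀ {n} (v : Vec ℕ n) j →
  atLeast j v ≡ occurrences v j + atLeast (suc j) v
atLeast-step []      j = refl
atLeast-step (x ∷ v) j with <-cmp x j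
... | tri< x<j x≢j _
  rewrite count-no (j ≤?_) {v = v} (<⇒≱ x<j)
        | count-no (_≟ j) {v = v} x≢j
        | count-no (suc j ≤?_) {v = v} (<⇒≱ (m<n⇒m<1+n x<j)) = atLeast-step v j
... | tri≈ _ x≡j _
  rewrite count-yes (j ≤?_) {v = v} (≤-reflexive (sym x≡j))
        | count-yes (_≟ j) {v = v} x≡j
        | count-no (suc j ≤?_) {v = v} (≤⇒≯ (≤-reflexive x≡j)) = cong suc (atLeast-step v j)
... | tri> _ x≢j j<x
  rewrite count-yes (j ≤?_) {v = v} (<⇒≤ j<x)
        | count-no (_≟ j) {v = v} x≢j
        | count-yes (suc j ≤?_) {v = v} j<x =
  trans (cong suc (atLeast-step v j)) (sym (+-suc _ _))

-- `f` comes with a pointwise equation because the recursion of `applyUpTo` composes it with `suc`,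
-- and `j + suc i` is not `suc j + i` by computation.
sum-occurrences : ∀ {n} (v : Vec ℕ n) (f : ℕ → ℕ) j l → (∀ i → f i ≡ j + i) →
  sum (applyUpTo (occurrences v ∘ f) l) + atLeast (j + l) v ≡ atLeast j v
sum-occurrences v f j zero    f≡ = cong (λ i → atLeast i v) (+-identityʳ j)
sum-occurrences v f j (suc l) f≡
  rewrite f≡ 0 | +-identityʳ j | +-suc j l =
  trans (+-assoc (occurrences v j) _ _)
    (trans (cong (occurrences v j +_)
             (sum-occurrences v (f ∘ suc) (suc j) l (λ i → trans (f≡ (suc i)) (+-suc j i))))
      (sym (atLeast-step v j)))

-- The sum telescopes to a difference of two tail counts, and the tail beyond `n` is empty since no
-- entry exceeds `n`.
excess≡ : ∀ {n} (α : Vec ℕ n) → (∀ i → lookup α i ≤ n) → ∀ {c} → c < n →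
  excess α (suc c) ≡ atLeast (suc c) α ⊖ (n ∸ c)
excess≡ {n} α α≤n {c} c<n = cong (_⊖ (n ∸ c)) (trans (sym (+-identityʳ _))
  (trans (cong (sum (applyUpTo (λ i → occurrences α (suc c + i)) (n ∸ c)) +_) (sym none))
    (sum-occurrences α (suc c +_) (suc c) (n ∸ c) (λ _ → refl))))
  where
  none : atLeast (suc c + (n ∸ c)) α ≡ 0
  none rewrite m+[n∸m]≡n (<⇒≤ c<n) = count≡0 (suc n ≤?_) α (λ i → ≤⇒≯ (α≤n i))

1≤⊖⇒> : ∀ a b → ℤ.+ 1 ℤ.≤ a ⊖ b → b < a
1≤⊖⇒> a b 1≤ with b <? a
... | yes b<a = b<a
... | no b≮a with ℤ.≤-trans 1≤ (ℤ.≤-trans (ℤ.⊖-monoˡ-≤ b (≮⇒≥ b≮a)) (ℤ.≤-reflexive (ℤ.n⊖n≡0 b)))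
... | ℤ.+≤+ ()

>⇒1≤⊖ : ∀ {a b} → b < a → ℤ.+ 1 ℤ.≤ a ⊖ b
>⇒1≤⊖ b<a rewrite ℤ.⊖-≥ (<⇒≤ b<a) = ℤ.+≤+ (m<n⇒0<n∸m b<a)

-- c + 1 ∈ U α, with both sides moved so that no subtraction occurs.
Over : ∀ {n} → Vec ℕ n → ℕ → Set
Over {n} α c = c < n × n < c + atLeast (suc c) α

module _ {n} (α : Vec ℕ n) (α≤n : ∀ i → lookup α i ≤ n) where

  U⇒Over : ∀ {c} → suc c ∈ U α → Over α c
  U⇒Over {c} ((_ , c<n) , 1≤) rewrite excess≡ α α≤n c<n =
    c<n , (begin-strict
      n                      ≡⟨ sym (m+[n∸m]≡n (<⇒≤ c<n)) ⟩
      c + (n ∸ c)            <⟨ +-monoʳ-< c (1≤⊖⇒> _ (n ∸ c) 1≤) ⟩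
      c + atLeast (suc c) α  ∎)
    where open ≤-Reasoning

  Over⇒U : ∀ {c} → Over α c → suc c ∈ U α
  Over⇒U {c} (c<n , n<) = (z<s , c<n) ,
    subst (ℤ.+ 1 ℤ.≤_) (sym (excess≡ α α≤n c<n)) (>⇒1≤⊖ (+-cancelˡ-< c _ _ (begin-strict
      c + (n ∸ c)            ≡⟨ m+[n∸m]≡n (<⇒≤ c<n) ⟩
      n                      <⟨ n< ⟩
      c + atLeast (suc c) α  ∎)))
    where open ≤-Reasoning

¬Over-zero : ∀ {n} (α : Vec ℕ n) → ¬ Over α 0
¬Over-zero α (_ , n<) = <⇒≱ n< (count≤n (1 ≤?_) α)

Over? : ∀ {n} (α : Vec ℕ n) c → Dec (Over α c)
Over? {n} α c = c <? n ×-dec n <? c + atLeast (suc c) α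

U? : ∀ {n} (α : Vec ℕ n) → (∀ i → lookup α i ≤ n) → Decidable (U α)
U? α α≤n zero    = no λ { ((() , _) , _) }
U? α α≤n (suc c) with Over? α c
... | yes over = yes (Over⇒U α α≤n over)
... | no ¬over = no (¬over ∘ U⇒Over α α≤n)

-- Searching for the ends of an interval

module _ {P : ℕ → Set} (P? : Decidable P) where

  last-from : ∀ d {p} → P p → ¬ P (d + p) →
    ∃ λ q → p ≤ q × (∀ {x} → p ≤ x → x ≤ q → P x) × ¬ P (suc q)
  last-from zero    Pp ¬P = contradiction Pp ¬P
  last-from (suc d) {p} Pp ¬P with P? (suc p)
  ... | no ¬Psp = p , ≤-refl , (λ p≤x x≤p → subst P (≤-antisym p≤x x≤p) Pp) , ¬Psp
  ... | yes Psp with q , p<q , all , ¬Psq ← last-from d Psp (¬P ∘ subst P (+-suc d p)) =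
    q , <⇒≤ p<q , all′ , ¬Psq
    where
    all′ : ∀ {x} → p ≤ x → x ≤ q → P x
    all′ p≤x x≤q with m≤n⇒m<n∨m≡n p≤x
    ... | inj₁ p<x  = all p<x x≤q
    ... | inj₂ refl = Pp

  last-before : ∀ {p r} → P p → ¬ P r → p ≤ r →
    ∃ λ q → p ≤ q × (∀ {x} → p ≤ x → x ≤ q → P x) × ¬ P (suc q)
  last-before {p} {r} Pp ¬Pr p≤r = last-from (r ∸ p) Pp (¬Pr ∘ subst P (m∸n+n≡m p≤r))

  first-to : ¬ P 0 → ∀ {q} → P q →
    ∃ λ p → p < q × (∀ {x} → p < x → x ≤ q → P x) × ¬ P p
  first-to ¬P0 {zero}  Pq = contradiction Pq ¬P0
  first-to ¬P0 {suc q} Psq with P? q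
  ... | no ¬Pq = q , ≤-refl , (λ q<x x≤q → subst P (≤-antisym q<x x≤q) Psq) , ¬Pq
  ... | yes Pq with p , p<q , all , ¬Pp ← first-to ¬P0 Pq =
    p , m<n⇒m<1+n p<q , all′ , ¬Pp
    where
    all′ : ∀ {x} → p < x → x ≤ suc q → P x
    all′ p<x x≤sq with m≤n⇒m<n∨m≡n x≤sq
    ... | inj₁ x<sq = all p<x (s≤s⁻¹ x<sq)
    ... | inj₂ refl = Psq

-- Parking on a street without right end

-- The parking rule as a relation that does not mention the length of the street. Parking at the
-- preferred spot is the backward case with `s` equal to `a`. In the forward case one condition
-- covers all inspected spots, and `a ≤ x + k` avoids a truncated subtraction.
record Lands (k : ℕ) (occ : List ℕ) (a s : ℕ) : Set where
  constructor lands
  field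
    positive : 1 ≤ s
    free     : s ∉ₗ occ
    manner   : (s ≤ a × a ≤ s + k × (∀ {x} → s < x → x ≤ a → x ∈ₗ occ)) ⊎
               (a < s × (∀ {x} → 1 ≤ x → a ≤ x + k → x < s → x ∈ₗ occ))

pattern back s≤a a≤s+k full = inj₁ (s≤a , a≤s+k , full)
pattern forth a<s full = inj₂ (a<s , full)

-- Unless the order of the spots already fails, whichever of `s` and `t` the car inspects first is
-- free, yet the other landing requires it to be full.
Lands-≮ : ∀ {k occ a s t} → Lands k occ a s → Lands k occ a t → ¬ s < t
Lands-≮ (lands _ _ (back _ _ full)) (lands _ t∉ (back t≤a _ _)) s<t =
  t∉ (full s<t t≤a)
Lands-≮ (lands 1≤s s∉ (back _ a≤s+k _)) (lands _ _ (forth _ full)) s<t =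
  s∉ (full 1≤s a≤s+k s<t)
Lands-≮ (lands _ _ (forth a<s _)) (lands _ _ (back t≤a _ _)) s<t =
  <-asym s<t (≤-<-trans t≤a a<s)
Lands-≮ (lands 1≤s s∉ (forth a<s _)) (lands _ _ (forth _ full)) s<t =
  s∉ (full 1≤s (≤-trans (<⇒≤ a<s) (m≤m+n _ _)) s<t)

Lands-unique : ∀ {k occ a s t} → Lands k occ a s → Lands k occ a t → s ≡ t
Lands-unique {s = s} {t} l m with <-cmp s t
... | tri< s<t _ _ = contradiction s<t (Lands-≮ l m)
... | tri≈ _ s≡t _ = s≡t
... | tri> _ _ t<s = contradiction t<s (Lands-≮ m l)

-- Landing agrees with the search along the route

infix 4 _∈?_
_∈?_ : (x : ℕ) (xs : List ℕ) → Dec (x ∈ₗ xs)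
_∈?_ = member? _≟_

data First (occ : List ℕ) : List ℕ → ℕ → Set where
  here : ∀ {s xs} → s ∉ₗ occ → First occ (s ∷ xs) s
  there : ∀ {x xs s} → x ∈ₗ occ → First occ xs s → First occ (x ∷ xs) s

First-free : ∀ {occ xs s} → First occ xs s → s ∉ₗ occ
First-free (here s∉)    = s∉
First-free (there _ fi) = First-free fi

find-just : ∀ occ xs {s} → find (λ s → ¬? (s ∈? occ)) xs ≡ just s → First occ xs s
find-just occ (x ∷ xs) eq with x ∈? occ
find-just occ (x ∷ xs) refl | no x∉  = here x∉
find-just occ (x ∷ xs) eq   | yes x∈ = there x∈ (find-just occ xs eq)

find-nothing : ∀ occ xs {s} → find (λ s → ¬? (s ∈? occ)) xs ≡ nothing →
  s ∈ₗ xs → s ∈ₗ occ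
find-nothing occ (x ∷ xs) eq s∈ with x ∈? occ
find-nothing occ (x ∷ xs) () s∈          | no _
find-nothing occ (x ∷ xs) eq (here refl) | yes x∈ = x∈
find-nothing occ (x ∷ xs) eq (there s∈)  | yes _  = find-nothing occ xs eq s∈

First-++ : ∀ {occ} xs {ys s} → First occ (xs ++ ys) s →
  First occ xs s ⊎ ((∀ {x} → x ∈ₗ xs → x ∈ₗ occ) × First occ ys s)
First-++ []       fi            = inj₂ ((λ ()) , fi)
First-++ (x ∷ xs) (here x∉)     = inj₁ (here x∉)
First-++ (x ∷ xs) (there x∈ fi) with First-++ xs fi
... | inj₁ fi′         = inj₁ (there x∈ fi′)
... | inj₂ (all , fi′) = inj₂ ((λ { (here refl) → x∈ ; (there y∈) → all y∈ }) , fi′)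

∈-backward : ∀ k {a s} → 1 ≤ s → s < a → a ≤ s + k → s ∈ₗ backward k a
∈-backward zero    {s = s} 1≤s s<a a≤ = contradiction (≤-trans a≤ (≤-reflexive (+-identityʳ s))) (<⇒≱ s<a)
∈-backward (suc k) {suc zero} (s≤s _) (s≤s ()) a≤
∈-backward (suc k) {suc (suc a)} {s} 1≤s s<a a≤ with m≤n⇒m<n∨m≡n (s≤s⁻¹ s<a)
... | inj₂ refl = here refl
... | inj₁ s<a′ = there (∈-backward k 1≤s s<a′ (s≤s⁻¹ (subst (suc (suc a) ≤_) (+-suc s k) a≤)))

First-backward : ∀ {occ} k {a s} → First occ (backward k a) s →
  1 ≤ s × s < a × a ≤ s + k × (∀ {x} → s < x → x < a → x ∈ₗ occ)
First-backward (suc k) {suc (suc a)} (here s∉) =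
  z<s , ≤-refl , s≤s (subst (suc a ≤_) (sym (+-suc a k)) (s≤s (m≤m+n a k))) ,
  λ s<x x<a → contradiction s<x (≤⇒≯ (s≤s⁻¹ x<a))
First-backward {occ} (suc k) {suc (suc a)} {s} (there a∈ fi)
  with 1≤s , s<a , a≤ , full ← First-backward k fi =
  1≤s , m<n⇒m<1+n s<a , subst (suc (suc a) ≤_) (sym (+-suc s k)) (s≤s a≤) , full′
  where
  full′ : ∀ {x} → s < x → x < suc (suc a) → x ∈ₗ occ
  full′ s<x x<ssa with m≤n⇒m<n∨m≡n (s≤s⁻¹ x<ssa)
  ... | inj₁ x<sa = full s<x x<sa
  ... | inj₂ refl = a∈

First-applyUpTo : ∀ {occ} (f : ℕ → ℕ) j l {s} → (∀ i → f i ≡ j + i) →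
  First occ (applyUpTo f l) s →
  j ≤ s × s < j + l × (∀ {x} → j ≤ x → x < s → x ∈ₗ occ)
First-applyUpTo f j (suc l) f≡ (here _) rewrite f≡ 0 | +-identityʳ j =
  ≤-refl , m<m+n j z<s , λ j≤x x<j → contradiction x<j (≤⇒≯ j≤x)
First-applyUpTo {occ} f j (suc l) {s} f≡ (there f0∈ fi)
  with j<s , s< , full ← First-applyUpTo (f ∘ suc) (suc j) l (λ i → trans (f≡ (suc i)) (+-suc j i)) fi =
  <⇒≤ j<s , subst (s <_) (sym (+-suc j l)) s< , full′
  where
  full′ : ∀ {x} → j ≤ x → x < s → x ∈ₗ occ
  full′ j≤x x<s with m≤n⇒m<n∨m≡n j≤x
  ... | inj₁ j<x  = full j<x x<s
  ... | inj₂ refl = subst (_∈ₗ occ) (trans (f≡ 0) (+-identityʳ j)) f0∈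

module _ {n k : ℕ} {occ : List ℕ} {a : ℕ} (1≤a : 1 ≤ a) (a≤n : a ≤ n) where

  park⇒Lands : ∀ {s} → park n k occ a ≡ just s → Lands k occ a s × s ≤ n
  park⇒Lands eq with find-just occ (route n k a) eq
  ... | here a∉ =
    lands 1≤a a∉ (back ≤-refl (m≤m+n a k) (λ a<x x≤a → contradiction a<x (≤⇒≯ x≤a))) , a≤n
  ... | there a∈ fi with First-++ (backward k a) fi
  ... | inj₁ fi′ with 1≤s , s<a , a≤ , full ← First-backward k fi′ =
    lands 1≤s (First-free fi′) (back (<⇒≤ s<a) a≤ full′) , ≤-trans (<⇒≤ s<a) a≤n
    where
    full′ : ∀ {x} → _ < x → x ≤ a → x ∈ₗ occ
    full′ s<x x≤a with m≤n⇒m<n∨m≡n x≤a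
    ... | inj₁ x<a  = full s<x x<a
    ... | inj₂ refl = a∈
  park⇒Lands {s} eq | there a∈ fi | inj₂ (all , fi′)
    with a<s , s< , full ← First-applyUpTo (suc a +_) (suc a) (n ∸ a) (λ _ → refl) fi′ =
    lands (≤-trans z<s a<s) (First-free fi′) (forth a<s full′) ,
    s≤s⁻¹ (subst (s <_) (cong suc (m+[n∸m]≡n a≤n)) s<)
    where
    full′ : ∀ {x} → 1 ≤ x → a ≤ x + k → x < s → x ∈ₗ occ
    full′ {x} 1≤x a≤x+k x<s with <-cmp x a
    ... | tri< x<a _ _  = all (∈-backward k 1≤x x<a a≤x+k)
    ... | tri≈ _ refl _ = a∈
    ... | tri> _ _ a<x  = full a<x x<s

  ∈-route : ∀ {s} → Lands k occ a s → s ≤ n → s ∈ₗ route n k a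
  ∈-route (lands 1≤s _ (back s≤a a≤ _)) s≤n with m≤n⇒m<n∨m≡n s≤a
  ... | inj₁ s<a  = there (∈-++⁺ˡ (∈-backward k 1≤s s<a a≤))
  ... | inj₂ refl = here refl
  ∈-route {s} (lands _ _ (forth a<s _)) s≤n =
    there (∈-++⁺ʳ (backward k a)
      (subst (_∈ₗ forward n a) (m+[n∸m]≡n a<s)
        (∈-applyUpTo⁺ (suc a +_) (∸-monoˡ-< (s≤s s≤n) a<s))))

  Lands⇒park : ∀ {s} → Lands k occ a s → s ≤ n → park n k occ a ≡ just s
  Lands⇒park l s≤n with park n k occ a in eq
  ... | just _  = cong just (Lands-unique (proj₁ (park⇒Lands eq)) l)
  ... | nothing = contradiction (find-nothing occ (route n k a) eq (∈-route l s≤n)) (Lands.free l)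

∈⇒≤sum : ∀ {x xs} → x ∈ₗ xs → x ≤ sum xs
∈⇒≤sum {xs = y ∷ ys} (here refl) = m≤m+n y (sum ys)
∈⇒≤sum {xs = y ∷ ys} (there x∈)  = ≤-trans (∈⇒≤sum x∈) (m≤n+m (sum ys) y)

-- On a street of `suc a + sum occ` spots the search succeeds: the last spot exceeds every occupied
-- one, so it is free, and it lies on the route as it is beyond `a`.
Lands-exists : ∀ k occ {a} → 1 ≤ a → ∃ (Lands k occ a)
Lands-exists k occ {a} 1≤a with park (suc a + sum occ) k occ a in eq
... | just s  = s , proj₁ (park⇒Lands 1≤a (≤-trans (n≤1+n a) (m≤m+n (suc a) (sum occ))) eq)
... | nothing = contradiction (∈⇒≤sum (find-nothing occ (route N k a) eq N∈route)) (<⇒≱ (s≤s (m≤n+m _ a)))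
  where
  N = suc a + sum occ
  N∈route : N ∈ₗ route N k a
  N∈route = there (∈-++⁺ʳ (backward k a)
    (∈-applyUpTo⁺ (suc a +_) (subst (sum occ <_) (sym (trans (cong (_∸ a) (sym (+-suc a (sum occ)))) (m+n∸m≡n a _))) ≤-refl)))

-- The final spots are an index, so they can be counted and compared with the preferences. Parking
-- within `n` spots becomes a bound on this vector.
data Run (k : ℕ) : List ℕ → ∀ {m} → Vec ℕ m → Vec ℕ m → Set where
  []  : ∀ {occ} → Run k occ [] []
  _∷_ : ∀ {occ a s m} {α ss : Vec ℕ m} →
        Lands k occ a s → Run k (s ∷ occ) α ss → Run k occ (a ∷ α) (s ∷ ss)

Run-exists : ∀ k occ {m} {α : Vec ℕ m} → All (1 ≤_) α → ∃ (Run k occ α)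
Run-exists k occ []          = [] , []
Run-exists k occ (1≤a ∷ 1≤α) with s , l ← Lands-exists k occ 1≤a
                             with ss , r ← Run-exists k (s ∷ occ) 1≤α = s ∷ ss , l ∷ r

AllPark⇒Run : ∀ {n k occ m} {α : Vec ℕ m} → All [ 1 , n ] α → AllPark n k occ α →
  ∃ λ ss → Run k occ α ss × (∀ i → lookup ss i ≤ n)
AllPark⇒Run []                  _             = [] , [] , λ ()
AllPark⇒Run ((1≤a , a≤n) ∷ all) (s , eq , ap)
  with l , s≤n ← park⇒Lands 1≤a a≤n eq
  with ss , r , ss≤n ← AllPark⇒Run all ap =
  s ∷ ss , l ∷ r , λ { zero → s≤n ; (suc i) → ss≤n i }

Run⇒AllPark : ∀ {n k occ m} {α ss : Vec ℕ m} → All [ 1 , n ] α → Run k occ α ss →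
  (∀ i → lookup ss i ≤ n) → AllPark n k occ α
Run⇒AllPark []                  []      _    = _
Run⇒AllPark ((1≤a , a≤n) ∷ all) (l ∷ r) ss≤n =
  _ , Lands⇒park 1≤a a≤n l (ss≤n zero) , Run⇒AllPark all r (ss≤n ∘ suc)

-- Distinct spots, crossings and counts in a run

module _ {k : ℕ} where

  Run-positive : ∀ {occ m} {α ss : Vec ℕ m} → Run k occ α ss → ∀ i → 1 ≤ lookup ss i
  Run-positive (l ∷ _) zero    = Lands.positive l
  Run-positive (_ ∷ r) (suc i) = Run-positive r i

  Run-free : ∀ {occ m} {α ss : Vec ℕ m} → Run k occ α ss → ∀ i → lookup ss i ∉ₗ occ
  Run-free (l ∷ _) zero    = Lands.free l
  Run-free (_ ∷ r) (suc i) = Run-free r i ∘ there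

  Run-occurrences≤1 : ∀ {occ m} {α ss : Vec ℕ m} → Run k occ α ss → ∀ x → occurrences ss x ≤ 1
  Run-occurrences≤1 []      x = z≤n
  Run-occurrences≤1 (_∷_ {s = s} {ss = ss} l r) x with s ≟ x
  ... | yes refl = ≤-reflexive (trans (count-yes (_≟ x) {v = ss} refl)
                     (cong suc (count≡0 (_≟ x) ss (λ i eq → Run-free r i (here eq)))))
  ... | no s≢x   = ≤-trans (≤-reflexive (count-no (_≟ x) {v = ss} s≢x)) (Run-occurrences≤1 r x)

  -- The spots a forward-moving car has seen are full from then on, and a later
  -- car coming from the other side can only see those.
  Lands-forth⇒no-later : ∀ {occ m a s} {α ss : Vec ℕ m} → a < s →
    (∀ {x} → 1 ≤ x → a ≤ x + k → x ≤ s → x ∈ₗ occ) → Run k occ α ss →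
    ∀ i → s ≤ lookup α i → ¬ lookup ss i ≤ s
  Lands-forth⇒no-later a<s full (lands 1≤t t∉ (back _ b≤t+k _) ∷ _) zero s≤b t≤s =
    t∉ (full 1≤t (≤-trans (<⇒≤ (<-≤-trans a<s s≤b)) b≤t+k) t≤s)
  Lands-forth⇒no-later a<s full (lands _ _ (forth b<t _) ∷ _) zero s≤b t≤s =
    <⇒≱ (<-≤-trans b<t t≤s) s≤b
  Lands-forth⇒no-later a<s full (_ ∷ r) (suc i) =
    Lands-forth⇒no-later a<s (λ 1≤x a≤ x≤s → there (full 1≤x a≤ x≤s)) r i

  -- If `i` arrives first, `Lands-forth⇒no-later` applies. If `j` arrives first, it finds
  -- `lookup ss i` full or takes it, so `i` cannot park there.
  no-crossing : ∀ {occ m} {α ss : Vec ℕ m} → Run k occ α ss → ∀ i j →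
    lookup α i < lookup ss i → lookup ss i ≤ lookup α j → ¬ lookup ss j ≤ lookup ss i
  no-crossing (_ ∷ _) zero zero a<s s≤a _ = <⇒≱ a<s s≤a
  no-crossing (lands _ _ (back s≤a _ _) ∷ _) zero (suc j) a<s = contradiction s≤a (<⇒≱ a<s)
  no-crossing {occ} (_∷_ {a = a} {s} (lands _ _ (forth _ full)) r) zero (suc j) a<s =
    Lands-forth⇒no-later a<s full′ r j
    where
    full′ : ∀ {x} → 1 ≤ x → a ≤ x + k → x ≤ s → x ∈ₗ s ∷ occ
    full′ 1≤x a≤ x≤s with m≤n⇒m<n∨m≡n x≤s
    ... | inj₁ x<s  = there (full 1≤x a≤ x<s)
    ... | inj₂ refl = here refl
  no-crossing (lands _ _ (forth b<t _) ∷ _) (suc i) zero a<s s≤b t≤s = <⇒≱ (<-≤-trans b<t t≤s) s≤b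
  no-crossing (lands _ _ (back t≤b _ full) ∷ r) (suc i) zero a<s s≤b t≤s with m≤n⇒m<n∨m≡n t≤s
  ... | inj₁ t<s = Run-free r i (there (full t<s s≤b))
  ... | inj₂ t≡s = Run-free r i (here (sym t≡s))
  no-crossing (_ ∷ r) (suc i) (suc j) = no-crossing r i j

  module _ {m} {α ss : Vec ℕ m} (r : Run k [] α ss) where

    -- Each of the `d` spots between the two thresholds holds at most one car.
    Run-atLeast-drop : ∀ d c → atLeast c ss ≤ d + atLeast (d + c) ss
    Run-atLeast-drop zero    c = ≤-refl
    Run-atLeast-drop (suc d) c = begin
      atLeast c ss                          ≡⟨ atLeast-step ss c ⟩
      occurrences ss c + atLeast (suc c) ss ≤⟨ +-mono-≤ (Run-occurrences≤1 r c) (Run-atLeast-drop d (suc c)) ⟩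
      suc (d + atLeast (d + suc c) ss)      ≡⟨ cong (λ e → suc (d + atLeast e ss)) (+-suc d c) ⟩
      suc d + atLeast (suc d + c) ss        ∎
      where open ≤-Reasoning

    module _ (ss≤m : ∀ i → lookup ss i ≤ m) where

      -- The drop from `suc c` to `suc m`, where the tail is empty, bounds the count above; the drop
      -- from 1, where the tail contains all `m` cars, bounds it below.
      Run-atLeast : ∀ {c} → c ≤ m → atLeast (suc c) ss + c ≡ m
      Run-atLeast {c} c≤m = ≤-antisym upper lower
        where
        open ≤-Reasoning
        upper : atLeast (suc c) ss + c ≤ m
        upper = begin
          atLeast (suc c) ss + c ≤⟨ +-monoˡ-≤ c (Run-atLeast-drop (m ∸ c) (suc c)) ⟩
          m ∸ c + atLeast (m ∸ c + suc c) ss + c ≡⟨ cong (λ e → m ∸ c + e + c) none ⟩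
          m ∸ c + 0 + c ≡⟨ cong (_+ c) (+-identityʳ (m ∸ c)) ⟩
          m ∸ c + c ≡⟨ m∸n+n≡m c≤m ⟩
          m ∎
          where
          none : atLeast (m ∸ c + suc c) ss ≡ 0
          none rewrite +-suc (m ∸ c) c | m∸n+n≡m c≤m = count≡0 (suc m ≤?_) ss (λ i → ≤⇒≯ (ss≤m i))
        lower : m ≤ atLeast (suc c) ss + c
        lower = begin
          m ≡⟨ sym (count≡n (1 ≤?_) ss (Run-positive r)) ⟩
          atLeast 1 ss ≤⟨ Run-atLeast-drop c 1 ⟩
          c + atLeast (c + 1) ss ≡⟨ cong (λ e → c + atLeast e ss) (+-comm c 1) ⟩
          c + atLeast (suc c) ss ≡⟨ +-comm c _ ⟩
          atLeast (suc c) ss + c ∎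

      Run-surjective : ∀ {x} → 1 ≤ x → x ≤ m → ∃ λ i → lookup ss i ≡ x
      Run-surjective {suc c} _ c<m = count>0 (_≟ suc c) ss (+-cancelʳ-< (atLeast (suc (suc c)) ss + c) _ _ (begin-strict
        atLeast (suc (suc c)) ss + c <⟨ ≤-reflexive (trans (sym (+-suc _ c)) (Run-atLeast c<m)) ⟩
        m ≡⟨ sym (Run-atLeast (<⇒≤ c<m)) ⟩
        atLeast (suc c) ss + c ≡⟨ cong (_+ c) (atLeast-step ss (suc c)) ⟩
        occurrences ss (suc c) + atLeast (suc (suc c)) ss + c ≡⟨ +-assoc (occurrences ss (suc c)) _ c ⟩
        occurrences ss (suc c) + (atLeast (suc (suc c)) ss + c) ∎))
        where open ≤-Reasoning

-- Restriction

subset : ∀ {n} {P : Fin n → Set} → Decidable P →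
  ∃ λ (J : Subset n) → (∀ {i} → i ∈ˢ J → P i) × (∀ {i} → P i → i ∈ˢ J)
subset {zero}  P? = [] , (λ ()) , λ { {()} }
subset {suc n} P? with J , J⇒ , ⇒J ← subset (P? ∘ suc) | P? zero
... | yes p0 = inside ∷ J , (λ { here → p0 ; (there i∈) → J⇒ i∈ }) ,
                            λ { {zero} _ → here ; {suc i} pi → there (⇒J pi) }
... | no ¬p0 = outside ∷ J , (λ { (there i∈) → J⇒ i∈ }) ,
                            λ { {zero} p0 → contradiction p0 ¬p0 ; {suc i} pi → there (⇒J pi) }

-- The equation holds for all `v` at once, so one translation of indices serves both preferences and
-- final spots.
∈-restrict : ∀ {n} (J : Subset n) i → ∃ λ j → j ∈ˢ J × ∀ v → lookup (restrict v J) i ≡ lookup v j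
∈-restrict (inside ∷ J) zero = zero , here , λ { (_ ∷ _) → refl }
∈-restrict (inside ∷ J) (suc i) with j , j∈ , eq ← ∈-restrict J i =
  suc j , there j∈ , λ { (_ ∷ v) → eq v }
∈-restrict (outside ∷ J) i with j , j∈ , eq ← ∈-restrict J i =
  suc j , there j∈ , λ { (_ ∷ v) → eq v }

restrict-∈ : ∀ {n} {J : Subset n} {j} → j ∈ˢ J → ∃ λ i → ∀ v → lookup (restrict v J) i ≡ lookup v j
restrict-∈ {J = inside ∷ J} here = zero , λ { (_ ∷ _) → refl }
restrict-∈ {J = inside ∷ J} (there j∈) with i , eq ← restrict-∈ j∈ =
  suc i , λ { (_ ∷ v) → eq v }
restrict-∈ {J = outside ∷ J} (there j∈) with i , eq ← restrict-∈ j∈ =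
  i , λ { (_ ∷ v) → eq v }

-- The two tail counts differ by the number of entries from `c` up to but excluding `d`; the smaller
-- one is moved to the other side to avoid subtraction.
∣J∣+atLeast≤ : ∀ {n} (J : Subset n) (v : Vec ℕ n) {c d} → c ≤ d →
  (∀ j → j ∈ˢ J → c ≤ lookup v j × lookup v j < d) → ∣ J ∣ + atLeast d v ≤ atLeast c v
∣J∣+atLeast≤ [] [] _ _ = z≤n
∣J∣+atLeast≤ (inside ∷ J) (x ∷ v) {c} {d} c≤d h with c≤x , x<d ← h zero here
  rewrite count-yes (c ≤?_) {v = v} c≤x | count-no (d ≤?_) {v = v} (<⇒≱ x<d) =
  s≤s (∣J∣+atLeast≤ J v c≤d (λ j → h (suc j) ∘ there))
∣J∣+atLeast≤ (outside ∷ J) (x ∷ v) {c} {d} c≤d h with d ≤? x | ∣J∣+atLeast≤ J v c≤d (λ j → h (suc j) ∘ there)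
... | yes d≤x | ih rewrite count-yes (d ≤?_) {v = v} d≤x | count-yes (c ≤?_) {v = v} (≤-trans c≤d d≤x)
  | +-suc ∣ J ∣ (atLeast d v) = s≤s ih
... | no d≰x | ih rewrite count-no (d ≤?_) {v = v} d≰x with c ≤? x
... | yes c≤x rewrite count-yes (c ≤?_) {v = v} c≤x = m≤n⇒m≤1+n ih
... | no c≰x  rewrite count-no (c ≤?_) {v = v} c≰x = ih

≤∣J∣+atLeast : ∀ {n} (J : Subset n) (v : Vec ℕ n) {c d} →
  (∀ j → c ≤ lookup v j → lookup v j < d → j ∈ˢ J) → atLeast c v ≤ ∣ J ∣ + atLeast d v
≤∣J∣+atLeast []      []      _ = z≤n
≤∣J∣+atLeast (b ∷ J) (x ∷ v) {c} {d} h = cons b (h zero)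
  where
  open ≤-Reasoning
  ih : atLeast c v ≤ ∣ J ∣ + atLeast d v
  ih = ≤∣J∣+atLeast J v (λ j c≤ <d → drop-there (h (suc j) c≤ <d))
  cons : ∀ b → (c ≤ x → x < d → zero ∈ˢ b ∷ J) →
    atLeast c (x ∷ v) ≤ ∣ b ∷ J ∣ + atLeast d (x ∷ v)
  cons inside _ = begin
    atLeast c (x ∷ v)                ≤⟨ count-∷ʳ (c ≤?_) x v ⟩
    suc (atLeast c v)                ≤⟨ s≤s ih ⟩
    suc (∣ J ∣ + atLeast d v)        ≤⟨ s≤s (+-monoʳ-≤ ∣ J ∣ (count-∷ˡ (d ≤?_) x v)) ⟩
    suc (∣ J ∣ + atLeast d (x ∷ v))  ∎
  cons outside x∈J with d ≤? x
  ... | yes d≤x = begin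
    atLeast c (x ∷ v)          ≤⟨ count-∷ʳ (c ≤?_) x v ⟩
    suc (atLeast c v)          ≤⟨ s≤s ih ⟩
    suc (∣ J ∣ + atLeast d v)  ≡⟨ sym (+-suc ∣ J ∣ _) ⟩
    ∣ J ∣ + suc (atLeast d v)  ≡⟨ cong (∣ J ∣ +_) (sym (count-yes (d ≤?_) {v = v} d≤x)) ⟩
    ∣ J ∣ + atLeast d (x ∷ v)  ∎
  ... | no d≰x = begin
    atLeast c (x ∷ v)          ≡⟨ count-no (c ≤?_) {v = v} c≰x ⟩
    atLeast c v                ≤⟨ ih ⟩
    ∣ J ∣ + atLeast d v        ≤⟨ +-monoʳ-≤ ∣ J ∣ (count-∷ˡ (d ≤?_) x v) ⟩
    ∣ J ∣ + atLeast d (x ∷ v)  ∎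
    where
    c≰x : ¬ c ≤ x
    c≰x c≤x with x∈J c≤x (≰⇒> d≰x)
    ... | ()

-- Runs of a shifted restriction against the whole street

module _ {k w : ℕ} where

  private
    +k+w : ∀ x → x + w + k ≡ x + k + w
    +k+w x = trans (+-assoc x w k) (trans (cong (x +_) (+-comm w k)) (sym (+-assoc x k w)))

  -- All inspected spots are at most `d`, where the two occupancies agree. Spots up to `w` vanish
  -- under the shift, which only removes conditions.
  Lands-shift : ∀ {occ occ′ b t d} → 1 ≤ t → b + w ≤ d → t + w ≤ d →
    (∀ {x} → 1 ≤ x → x + w ≤ d → x + w ∈ₗ occ → x ∈ₗ occ′) →
    (t ∈ₗ occ′ → t + w ∈ₗ occ) →
    Lands k occ (b + w) (t + w) → Lands k occ′ b t
  Lands-shift {t = t} 1≤t b≤d t≤d occ⊆ t∈ (lands _ t∉ (back t≤b b≤ full)) =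
    lands 1≤t (t∉ ∘ t∈) (back (+-cancelʳ-≤ w _ _ t≤b)
      (+-cancelʳ-≤ w _ _ (≤-trans b≤ (≤-reflexive (+k+w t))))
      (λ t<x x≤b → occ⊆ (≤-trans z<s t<x) (≤-trans (+-monoˡ-≤ w x≤b) b≤d)
        (full (+-monoˡ-< w t<x) (+-monoˡ-≤ w x≤b))))
  Lands-shift 1≤t b≤d t≤d occ⊆ t∈ (lands _ t∉ (forth b<t full)) =
    lands 1≤t (t∉ ∘ t∈) (forth (+-cancelʳ-< w _ _ b<t)
      (λ {x} 1≤x b≤ x<t → occ⊆ 1≤x (≤-trans (<⇒≤ (+-monoˡ-< w x<t)) t≤d)
        (full (≤-trans 1≤x (m≤m+n x w))
          (≤-trans (+-monoˡ-≤ w b≤) (≤-reflexive (sym (+k+w x))))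
          (+-monoˡ-< w x<t))))

  -- `J` consists of exactly the cars ending in `(w, d]`, so the other cars do not change the
  -- occupancy of this window. The last two hypotheses say that `occ′` is the shifted occupancy
  -- there, and each step preserves them.
  Run-restrict : ∀ {d n} {α ss : Vec ℕ n} {occ occ′} → Run k occ α ss →
    (J : Subset n) →
    (∀ j → j ∈ˢ J → w < lookup ss j × lookup ss j ≤ d) →
    (∀ j → w < lookup ss j → lookup ss j ≤ d → j ∈ˢ J) →
    (∀ j → j ∈ˢ J → w < lookup α j × lookup α j ≤ d) →
    (∀ {x} → 1 ≤ x → x + w ≤ d → x + w ∈ₗ occ → x ∈ₗ occ′) →
    (∀ {x} → 1 ≤ x → x + w ≤ d → x ∈ₗ occ′ → x + w ∈ₗ occ) →
    Run k occ′ (τ w (restrict α J)) (τ w (restrict ss J))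
  Run-restrict [] [] _ _ _ _ _ = []
  Run-restrict {d} {occ = occ} {occ′} (_∷_ {a = a} {s} l r) (inside ∷ J) J⇒ ⇒J α∈ occ⊆ occ⊇
    with w<s , s≤d ← J⇒ zero here | w<a , a≤d ← α∈ zero here =
    Lands-shift (m<n⇒0<n∸m w<s) (≤-trans (≤-reflexive a≡) a≤d) s′≤d occ⊆
      (occ⊇ (m<n⇒0<n∸m w<s) s′≤d)
      (subst (λ e → Lands k occ e (s ∸ w + w)) (sym a≡) (subst (Lands k occ a) (sym s≡) l))
    ∷ Run-restrict r J (λ j → J⇒ (suc j) ∘ there) (λ j w< ≤d → drop-there (⇒J (suc j) w< ≤d))
        (λ j → α∈ (suc j) ∘ there)
        (λ { {x} 1≤x x≤d (here x≡) → here (trans (sym (m+n∸n≡m x w)) (cong (_∸ w) x≡))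
           ; 1≤x x≤d (there x∈) → there (occ⊆ 1≤x x≤d x∈) })
        (λ { 1≤x x≤d (here refl) → here s≡
           ; 1≤x x≤d (there x∈) → there (occ⊇ 1≤x x≤d x∈) })
    where
    a≡ : a ∸ w + w ≡ a
    a≡ = m∸n+n≡m (<⇒≤ w<a)
    s≡ : s ∸ w + w ≡ s
    s≡ = m∸n+n≡m (<⇒≤ w<s)
    s′≤d : s ∸ w + w ≤ d
    s′≤d = ≤-trans (≤-reflexive s≡) s≤d
  Run-restrict (l ∷ r) (outside ∷ J) J⇒ ⇒J α∈ occ⊆ occ⊇ =
    Run-restrict r J (λ j → J⇒ (suc j) ∘ there) (λ j w< ≤d → drop-there (⇒J (suc j) w< ≤d))
      (λ j → α∈ (suc j) ∘ there)
      (λ { {x} 1≤x x≤d (here refl) → contradiction (⇒J zero (m<n+m w 1≤x) x≤d) λ ()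
         ; 1≤x x≤d (there x∈) → occ⊆ 1≤x x≤d x∈ })
      (λ 1≤x x≤d x∈ → there (occ⊇ 1≤x x≤d x∈))

  module _ {f : ℕ} (1≤f : 1 ≤ f) where

    -- Only spots beyond `f` have to be full. This is clear for a backward move. A car moving
    -- forward past the free spot `f` cannot have inspected it, so `f + k < b`, and on the whole
    -- street too its backward search stops before `f + w`.
    Lands-unshift : ∀ {occ occ′ b t} → f ≤ t → (f ≤ b ⊎ f < t) → f ∉ₗ occ′ →
      (∀ {x} → f < x → x ∈ₗ occ′ → x + w ∈ₗ occ) → t + w ∉ₗ occ →
      Lands k occ′ b t → Lands k occ (b + w) (t + w)
    Lands-unshift {occ} {b = b} {t} f≤t _ f∉ occ⊇ t∉ (lands 1≤t _ (back t≤b b≤ full)) =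
      lands (≤-trans 1≤t (m≤m+n t w)) t∉
        (back (+-monoˡ-≤ w t≤b) (≤-trans (+-monoˡ-≤ w b≤) (≤-reflexive (sym (+k+w t)))) full′)
      where
      full′ : ∀ {x} → t + w < x → x ≤ b + w → x ∈ₗ occ
      full′ {x} t<x x≤b = subst (_∈ₗ occ) x≡ (occ⊇ (≤-<-trans f≤t t<x′)
        (full t<x′ (+-cancelʳ-≤ w _ _ (≤-trans (≤-reflexive x≡) x≤b))))
        where
        x≡ : x ∸ w + w ≡ x
        x≡ = m∸n+n≡m (≤-trans (m≤n+m w t) (<⇒≤ t<x))
        t<x′ : t < x ∸ w
        t<x′ = +-cancelʳ-< w _ _ (<-≤-trans t<x (≤-reflexive (sym x≡)))
    Lands-unshift {occ} {b = b} {t} f≤t f≤b⊎f<t f∉ occ⊇ t∉ (lands 1≤t _ (forth b<t full)) =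
      lands (≤-trans 1≤t (m≤m+n t w)) t∉ (forth (+-monoˡ-< w b<t) full′)
      where
      f<t : f < t
      f<t = [ (λ f≤b → ≤-<-trans f≤b b<t) , id ]′ f≤b⊎f<t
      f+k<b : f + k < b
      f+k<b = ≰⇒> (λ b≤ → f∉ (full 1≤f b≤ f<t))
      full′ : ∀ {x} → 1 ≤ x → b + w ≤ x + k → x < t + w → x ∈ₗ occ
      full′ {x} _ b≤ x<t = subst (_∈ₗ occ) x≡ (occ⊇ f<x′ (full (≤-trans z<s f<x′)
        (+-cancelʳ-≤ w _ _ (≤-trans b≤ (≤-reflexive (trans (cong (_+ k) (sym x≡)) (+k+w (x ∸ w))))))
        (+-cancelʳ-< w _ _ (≤-<-trans (≤-reflexive x≡) x<t))))
        where
        f+w<x : f + w < x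
        f+w<x = +-cancelʳ-< k _ _ (<-≤-trans
          (≤-<-trans (≤-reflexive (+k+w f)) (+-monoˡ-< w f+k<b)) b≤)
        x≡ : x ∸ w + w ≡ x
        x≡ = m∸n+n≡m (≤-trans (m≤n+m w f) (<⇒≤ f+w<x))
        f<x′ : f < x ∸ w
        f<x′ = +-cancelʳ-< w _ _ (<-≤-trans f+w<x (≤-reflexive (sym x≡)))

    -- Until f is taken in the run of the restriction, every spot beyond f that
    -- is full there is also full on the whole street.
    Run-restrict-fills : ∀ {n} {α ss : Vec ℕ n} {occ occ′} → Run k occ α ss →
      (J : Subset n) → (∀ j → j ∈ˢ J → w ≤ lookup α j) →
      ∀ {tt} → Run k occ′ (τ w (restrict α J)) tt →
      f ∉ₗ occ′ → f + w ∉ₗ occ → (∀ j → lookup ss j ≢ f + w) →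
      (∀ {x} → f < x → x ∈ₗ occ′ → x + w ∈ₗ occ) →
      ∀ i → lookup tt i ≡ f → ¬ f ≤ lookup (τ w (restrict α J)) i
    Run-restrict-fills (l ∷ r) (outside ∷ J) w≤α r′ f∉ fw∉ ss≢ occ⊇ =
      Run-restrict-fills r J (λ j → w≤α (suc j) ∘ there) r′ f∉
        (λ { (here eq) → ss≢ zero (sym eq) ; (there fw∈) → fw∉ fw∈ }) (ss≢ ∘ suc)
        (λ f<x x∈ → there (occ⊇ f<x x∈))
    Run-restrict-fills {occ = occ} (_∷_ {a = a} l r) (inside ∷ J) w≤α (l′ ∷ r′) f∉ fw∉ ss≢ occ⊇ zero refl f≤b =
      -- Coming from `f` or beyond, the car would take `f + w` on the whole street as well, where no
      -- car parks.
      ss≢ zero (Lands-unique l (subst (λ e → Lands k occ e (f + w)) (m∸n+n≡m (w≤α zero here))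
        (Lands-unshift ≤-refl (inj₁ f≤b) f∉ occ⊇ fw∉ l′)))
    Run-restrict-fills {occ = occ} {occ′} (_∷_ {a = a} {s} l r) (inside ∷ J) w≤α (_∷_ {s = t} l′ r′) f∉ fw∉ ss≢ occ⊇ (suc i) ti≡f =
      Run-restrict-fills r J (λ j → w≤α (suc j) ∘ there) r′
        (λ { (here eq) → f≢t eq ; (there f∈) → f∉ f∈ })
        (λ { (here eq) → ss≢ zero (sym eq) ; (there fw∈) → fw∉ fw∈ }) (ss≢ ∘ suc)
        occ⊇′ i ti≡f
      where
      f≢t : f ≢ t
      f≢t f≡t = Run-free r′ i (here (trans ti≡f f≡t))
      occ⊇′ : ∀ {x} → f < x → x ∈ₗ t ∷ occ′ → x + w ∈ₗ s ∷ occ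
      occ⊇′ f<x (there x∈) = there (occ⊇ f<x x∈)
      -- If `t + w` is not yet full on the whole street, then this same car parks there now.
      occ⊇′ f<t (here refl) with t + w ∈? occ
      ... | yes tw∈ = there tw∈
      ... | no tw∉  = here (sym (Lands-unique l
            (subst (λ e → Lands k occ e (t + w)) (m∸n+n≡m (w≤α zero here))
              (Lands-unshift (<⇒≤ f<t) (inj₂ f<t) f∉ occ⊇ tw∉ l′))))

-- Crossings and filled spots

module _ {k : ℕ} where

  Run-forth-full : ∀ {occ m} {α ss : Vec ℕ m} → Run k occ α ss → ∀ i {x} →
    1 ≤ x → lookup α i ≤ x → x < lookup ss i → x ∈ₗ occ ⊎ ∃ λ j → lookup ss j ≡ x
  Run-forth-full (lands _ _ (back s≤a _ _) ∷ _) zero 1≤x a≤x x<s =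
    contradiction s≤a (<⇒≱ (≤-<-trans a≤x x<s))
  Run-forth-full (lands _ _ (forth _ full) ∷ _) zero 1≤x a≤x x<s =
    inj₁ (full 1≤x (≤-trans a≤x (m≤m+n _ k)) x<s)
  Run-forth-full (_ ∷ r) (suc i) 1≤x a≤x x<s with Run-forth-full r i 1≤x a≤x x<s
  ... | inj₁ (here x≡s) = inj₂ (zero , sym x≡s)
  ... | inj₁ (there x∈) = inj₁ x∈
  ... | inj₂ (j , eq)   = inj₂ (suc j , eq)

  -- Otherwise every car preferring a spot beyond `c` also parks beyond `c`, where only `m - c` cars
  -- end.
  Run-crossing : ∀ {m} {α ss : Vec ℕ m} → Run k [] α ss → (∀ i → lookup ss i ≤ m) →
    ∀ {c} → Over α c → ∃ λ i → c < lookup α i × lookup ss i ≤ c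
  Run-crossing {m} {α} {ss} r ss≤m {c} (c<m , m<)
    with any? (λ i → c <? lookup α i ×-dec lookup ss i ≤? c)
  ... | yes crossing = crossing
  ... | no none = contradiction m< (≤⇒≯ (begin
    c + atLeast (suc c) α   ≤⟨ +-monoʳ-≤ c (count-mono (suc c ≤?_) (suc c ≤?_) α ss
                                (λ i c<a → ≰⇒> (λ s≤c → none (i , c<a , s≤c)))) ⟩
    c + atLeast (suc c) ss  ≡⟨ +-comm c _ ⟩
    atLeast (suc c) ss + c  ≡⟨ Run-atLeast r ss≤m (<⇒≤ c<m) ⟩
    m                       ∎))
    where open ≤-Reasoning

atLeast-filled : ∀ {n} (v : Vec ℕ n) d f →
  (∀ {x} → f < x → x ≤ d + f → ∃ λ i → lookup v i ≡ x) →
  d + atLeast (suc d + f) v ≤ atLeast (suc f) v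
atLeast-filled v zero    f filled = ≤-refl
atLeast-filled v (suc d) f filled = begin
  suc d + atLeast (suc (suc d) + f) v              ≡⟨ cong (λ e → suc d + atLeast (suc e) v) (sym (+-suc d f)) ⟩
  suc (d + atLeast (suc d + suc f) v)              ≤⟨ s≤s (atLeast-filled v d (suc f) filled′) ⟩
  suc (atLeast (suc (suc f)) v)                    ≤⟨ +-monoˡ-≤ _ occurs ⟩
  occurrences v (suc f) + atLeast (suc (suc f)) v  ≡⟨ sym (atLeast-step v (suc f)) ⟩
  atLeast (suc f) v                                ∎
  where
  open ≤-Reasoning
  filled′ : ∀ {x} → suc f < x → x ≤ d + suc f → ∃ λ i → lookup v i ≡ x
  filled′ f<x x≤ = filled (<⇒≤ f<x) (≤-trans x≤ (≤-reflexive (+-suc d f)))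
  occurs : 1 ≤ occurrences v (suc f)
  occurs with i , eq ← filled {suc f} ≤-refl (s≤s (m≤n+m f d)) = count-positive (_≟ suc f) v i eq

module _ {k n : ℕ} {α : Vec ℕ n} (α∈ : PP α) where

  private
    α≤n : ∀ i → lookup α i ≤ n
    α≤n = proj₂ ∘ lookup⁺ α∈

  Blocks : Set
  Blocks = (p q : ℕ) → MaximalInterval p q (U α) →
    ∃ λ (J : Subset n) →
      ((j : Fin n) → j ∈ˢ J → lookup α j ∈ [ p , (p ∸ 2) + ∣ J ∣ ]) ×
      Complete (τ (p ∸ 2) (restrict α J)) ×
      PF k (τ (p ∸ 2) (restrict α J))

  -- From a parking function to the block of a maximal interval

  module _ {ss : Vec ℕ n} (r : Run k [] α ss) (ss≤n : ∀ i → lookup ss i ≤ n)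
           {w : ℕ} (¬U-w : ¬ suc w ∈ U α) (U-p : suc (suc w) ∈ U α) where

    private
      over : Over α (suc w)
      over = U⇒Over α α≤n U-p

      w<n : w < n
      w<n = <⇒≤ (proj₁ over)

      -- A car preferring `suc w` would offset the one additional spot, so the excess would still be
      -- positive at `suc w`.
      α≢suc-w : ∀ j → lookup α j ≢ suc w
      α≢suc-w j aj≡ = ¬U-w (Over⇒U α α≤n (w<n , (begin-strict
        n                                     <⟨ proj₂ over ⟩
        suc w + atLeast (suc (suc w)) α       ≡⟨ sym (+-suc w _) ⟩
        w + suc (atLeast (suc (suc w)) α)     ≤⟨ +-monoʳ-≤ w
          (count-mono-< (suc (suc w) ≤?_) (suc w ≤?_) α α (λ _ → <⇒≤) j
            (<⇒≱ (s≤s (≤-reflexive aj≡))) (≤-reflexive (sym aj≡))) ⟩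
        w + atLeast (suc w) α                 ∎)))
        where open ≤-Reasoning

      -- The bound `w < lookup ss y` keeps the crossing car in the block, so that the crossing
      -- survives the restriction to `J`.
      Crossed : ℕ → Set
      Crossed j = ∃ λ y → j ≤ lookup α y × w < lookup ss y × lookup ss y < j

      Crossed? : Decidable Crossed
      Crossed? j = any? (λ y → j ≤? lookup α y ×-dec w <? lookup ss y ×-dec lookup ss y <? j)

      -- The car `y` given by counting may end to the left of the block, so the witness is the car
      -- `x` that takes `suc w`. By `α≢suc-w` it does not prefer this spot, and because of `y` it
      -- cannot come from the left.
      crossed-p : Crossed (suc (suc w))
      crossed-p with x , sx≡ ← Run-surjective r ss≤n z<s w<n
                with <-cmp (lookup α x) (suc w)
      ... | tri> _ _ a> = x , a> , ≤-reflexive (sym sx≡) , s≤s (≤-reflexive sx≡)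
      ... | tri≈ _ a≡ _ = contradiction a≡ (α≢suc-w x)
      ... | tri< a< _ _ with y , w<ay , sy≤w ← Run-crossing r ss≤n over =
        contradiction (≤-trans sy≤w (≤-reflexive (sym sx≡)))
          (no-crossing r x y (<-≤-trans a< (≤-reflexive (sym sx≡)))
            (≤-trans (≤-reflexive sx≡) (<⇒≤ w<ay)))

      module Block {d : ℕ} (w+2≤d : suc (suc w) ≤ d)
        (crossed : ∀ {x} → suc (suc w) ≤ x → x ≤ d → Crossed x) (¬crossed-d : ¬ Crossed (suc d))
        (J : Subset n) (J⇒ : ∀ {j} → j ∈ˢ J → w < lookup ss j × lookup ss j ≤ d)
        (⇒J : ∀ {j} → w < lookup ss j → lookup ss j ≤ d → j ∈ˢ J) where

        d≤n : d ≤ n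
        d≤n with y , d≤a , _ ← crossed w+2≤d ≤-refl = ≤-trans d≤a (α≤n y)

        -- The cars fill all the spots, so the tail counts of `ss` at both ends of the block are
        -- known, and they differ by the size of `J`.
        ∣J∣+w≡d : ∣ J ∣ + w ≡ d
        ∣J∣+w≡d = +-cancelˡ-≡ (atLeast (suc d) ss) _ _ (begin
          atLeast (suc d) ss + (∣ J ∣ + w)  ≡⟨ sym (+-assoc (atLeast (suc d) ss) ∣ J ∣ w) ⟩
          atLeast (suc d) ss + ∣ J ∣ + w    ≡⟨ cong (_+ w) (+-comm (atLeast (suc d) ss) ∣ J ∣) ⟩
          ∣ J ∣ + atLeast (suc d) ss + w    ≡⟨ cong (_+ w) (≤-antisym
            (∣J∣+atLeast≤ J ss (s≤s (≤-trans (n≤1+n w) (<⇒≤ w+2≤d)))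
              (λ j j∈ → proj₁ (J⇒ j∈) , s≤s (proj₂ (J⇒ j∈))))
            (≤∣J∣+atLeast J ss (λ j w<s s≤d → ⇒J w<s (s≤s⁻¹ s≤d)))) ⟩
          atLeast (suc w) ss + w            ≡⟨ Run-atLeast r ss≤n (<⇒≤ w<n) ⟩
          n                                 ≡⟨ sym (Run-atLeast r ss≤n d≤n) ⟩
          atLeast (suc d) ss + d            ∎)
          where open ≡-Reasoning

        -- A preference beyond `d` would make the edge at `suc d` crossed. A car preferring a spot
        -- up to `suc w` would have moved forward to its spot, against the backward crossing there.
        J-prefs : ∀ j → j ∈ˢ J → suc w < lookup α j × lookup α j ≤ d
        J-prefs j j∈ with w<s , s≤d ← J⇒ j∈ = ≰⇒> ¬a≤ , ≮⇒≥ ¬d<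
          where
          ¬d< : ¬ d < lookup α j
          ¬d< d<a = ¬crossed-d (j , d<a , w<s , s≤s s≤d)
          crossed-s : suc w ≤ lookup ss j → ∃ λ y → lookup ss j ≤ lookup α y × lookup ss y ≤ lookup ss j
          crossed-s w<s with m≤n⇒m<n∨m≡n w<s
          -- The edges known to be crossed start at `suc (suc w)`; for the leftmost spot `suc w` of
          -- the block the edge to its right serves.
          ... | inj₁ sw<s = let y , s≤a , _ , sy<s = crossed sw<s s≤d in y , s≤a , <⇒≤ sy<s
          ... | inj₂ sw≡s = let y , w<a , _ , sy<w = crossed-p in
            y , ≤-trans (≤-reflexive (sym sw≡s)) (<⇒≤ w<a) , ≤-trans (s≤s⁻¹ sy<w) (≤-reflexive sw≡s)
          ¬a≤ : ¬ lookup α j ≤ suc w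
          ¬a≤ a≤ with y , s≤a , sy≤s ← crossed-s w<s =
            no-crossing r j y (<-≤-trans (≤∧≢⇒< a≤ (α≢suc-w j)) w<s) s≤a sy≤s

        m : ℕ
        m = ∣ J ∣

        β tt : Vec ℕ m
        β  = τ w (restrict α J)
        tt = τ w (restrict ss J)

        lookup-τ : ∀ {i j} → (∀ v → lookup (restrict v J) i ≡ lookup v j) →
          ∀ v → lookup (τ w (restrict v J)) i ≡ lookup v j ∸ w
        lookup-τ {i} eq v = trans (lookup-map i (_∸ w) (restrict v J)) (cong (_∸ w) (eq v))

        d∸w≡m : d ∸ w ≡ m
        d∸w≡m = trans (cong (_∸ w) (sym ∣J∣+w≡d)) (m+n∸n≡m m w)

        β∈ : ∀ i → lookup β i ∈ [ 1 , m ]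
        β∈ i with j , j∈ , eq ← ∈-restrict J i
             with w<a , a≤d ← J-prefs j j∈ rewrite lookup-τ eq α =
          m<n⇒0<n∸m (<⇒≤ w<a) , ≤-trans (∸-monoˡ-≤ w a≤d) (≤-reflexive d∸w≡m)

        tt≤m : ∀ i → lookup tt i ≤ m
        tt≤m i with j , j∈ , eq ← ∈-restrict J i rewrite lookup-τ eq ss =
          ≤-trans (∸-monoˡ-≤ w (proj₂ (J⇒ j∈))) (≤-reflexive d∸w≡m)

        rβ : Run k [] β tt
        rβ = Run-restrict r J (λ _ → J⇒) (λ _ → ⇒J) (λ j j∈ → <⇒≤ (proj₁ (J-prefs j j∈)) , proj₂ (J-prefs j j∈))
          (λ _ _ ()) (λ _ _ ())

        crossed-β : ∀ {c} → 2 ≤ c → c ≤ m → ∃ λ i → c ≤ lookup β i × lookup tt i < c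
        crossed-β {c} 2≤c c≤m
          with y , c≤a , w<s , s<c ← crossed (+-monoˡ-≤ w 2≤c) (≤-trans (+-monoˡ-≤ w c≤m) (≤-reflexive ∣J∣+w≡d))
          with i , eq ← restrict-∈ (⇒J w<s (≤-trans (<⇒≤ s<c) (≤-trans (+-monoˡ-≤ w c≤m) (≤-reflexive ∣J∣+w≡d)))) =
          i , ≤-trans (m+n≤o⇒m≤o∸n c c≤a) (≤-reflexive (sym (lookup-τ eq α))) ,
          ≤-<-trans (≤-reflexive (lookup-τ eq ss))
            (<-≤-trans (∸-monoˡ-< s<c (<⇒≤ w<s)) (≤-reflexive (m+n∸n≡m c w)))

        -- No car crosses `c` forward, so the cars ending beyond `c`, which number `m - c`, all
        -- prefer spots beyond `c`. A car crossing backward makes the inequality strict.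
        over-β : ∀ {c} → 1 ≤ c → c < m → Over β c
        over-β {c} 1≤c c<m = c<m , (begin-strict
          m                       ≡⟨ sym (Run-atLeast rβ tt≤m (<⇒≤ c<m)) ⟩
          atLeast (suc c) tt + c  ≡⟨ +-comm _ c ⟩
          c + atLeast (suc c) tt  <⟨ +-monoʳ-< c tt<β ⟩
          c + atLeast (suc c) β   ∎)
          where
          open ≤-Reasoning
          tt⇒β : ∀ i → suc c ≤ lookup tt i → suc c ≤ lookup β i
          tt⇒β i c<t = ≰⇒> λ b≤c →
            let y , t≤b , t< = crossed-β (≤-trans (s≤s 1≤c) c<t) (tt≤m i)
            in no-crossing rβ i y (≤-<-trans b≤c c<t) t≤b (<⇒≤ t<)
          tt<β : atLeast (suc c) tt < atLeast (suc c) β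
          tt<β =
            let y , c<b , t≤c = crossed-β (s≤s 1≤c) c<m
            in count-mono-< (suc c ≤?_) (suc c ≤?_) tt β tt⇒β y (<⇒≱ t≤c) c<b

        complete : Complete β
        complete = record
          { length≥2   = +-cancelʳ-≤ w 2 m (≤-trans w+2≤d (≤-reflexive (sym ∣J∣+w≡d)))
          ; preference = lookup⁻ β∈
          ; U≐[2,n]    = ⊆ , ⊇
          }
          where
          ⊆ : ∀ {j} → j ∈ U β → j ∈ [ 2 , m ]
          ⊆ {zero}        ((() , _) , _)
          ⊆ {suc zero}    u              = contradiction (U⇒Over β (proj₂ ∘ β∈) u) (¬Over-zero β)
          ⊆ {suc (suc _)} ((_ , j≤m) , _) = s≤s z<s , j≤m
          ⊇ : ∀ {j} → j ∈ [ 2 , m ] → j ∈ U β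
          ⊇ {suc c} (s≤s 1≤c , c<m) = Over⇒U β (proj₂ ∘ β∈) (over-β 1≤c c<m)

        J-valid :
          (∀ j → j ∈ˢ J → lookup α j ∈ [ suc (suc w) , w + ∣ J ∣ ]) ×
          Complete (τ w (restrict α J)) × PF k (τ w (restrict α J))
        J-valid =
          (λ j j∈ → proj₁ (J-prefs j j∈) ,
            ≤-trans (proj₂ (J-prefs j j∈)) (≤-reflexive (trans (sym ∣J∣+w≡d) (+-comm m w)))) ,
          complete , lookup⁻ β∈ , Run⇒AllPark (lookup⁻ β∈) rβ tt≤m

    complete-block : ∃ λ (J : Subset n) →
      ((j : Fin n) → j ∈ˢ J → lookup α j ∈ [ suc (suc w) , w + ∣ J ∣ ]) ×
      Complete (τ w (restrict α J)) × PF k (τ w (restrict α J))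
    complete-block
      -- The edge at `suc n` is not crossed, as no preference exceeds `n`; this bounds the search
      -- for `d`.
      with d , w+2≤d , crossed , ¬crossed-d ← last-before Crossed? crossed-p
             (λ { (y , n<a , _) → <⇒≱ n<a (α≤n y) }) (<⇒≤ (s≤s (proj₁ over)))
      with J , J⇒ , ⇒J ← subset (λ i → w <? lookup ss i ×-dec lookup ss i ≤? d) =
      J , Block.J-valid w+2≤d crossed ¬crossed-d J J⇒ (λ w<s s≤d → ⇒J (w<s , s≤d))

  PF⇒blocks : PF k α → Blocks
  -- A maximal interval starts at 2 or later: 0 is not in `[ 1 , n ]`, and the excess at 1 is not
  -- positive.
  PF⇒blocks (_ , ap) zero q mi with MaximalInterval.included mi (≤-refl , MaximalInterval.nonempty mi)
  ... | (() , _) , _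
  PF⇒blocks (_ , ap) (suc zero) q mi =
    contradiction (U⇒Over α α≤n (MaximalInterval.included mi (≤-refl , MaximalInterval.nonempty mi)))
      (¬Over-zero α)
  PF⇒blocks (_ , ap) (suc (suc w)) q mi with ss , r , ss≤n ← AllPark⇒Run α∈ ap =
    complete-block r ss≤n ¬U-w (included (≤-refl , nonempty))
    where
    open MaximalInterval mi
    ¬U-w : ¬ suc w ∈ U α
    ¬U-w u = <⇒≱ ≤-refl (proj₁ (maximal (suc w) q (λ { (p≤x , x≤q) → <⇒≤ p≤x , x≤q }) extended
      (≤-refl , <⇒≤ nonempty)))
      where
      extended : ∀ {x} → x ∈ [ suc w , q ] → x ∈ U α
      extended (p≤x , x≤q) with m≤n⇒m<n∨m≡n p≤x
      ... | inj₁ p<x  = included (p<x , x≤q)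
      ... | inj₂ refl = u

  -- From blocks to a parking function

  module _ (blocks : Blocks) {ss : Vec ℕ n} (r : Run k [] α ss) where

    private
      Taken : ℕ → Set
      Taken x = ∃ λ i → lookup ss i ≡ x

      Taken? : Decidable Taken
      Taken? x = any? (λ i → lookup ss i ≟ x)

      taken : ∀ i {x} → 1 ≤ x → lookup α i ≤ x → x < lookup ss i → Taken x
      taken i 1≤x a≤x x<s with Run-forth-full r i 1≤x a≤x x<s
      ... | inj₂ t = t

      -- No car moves forward over the free spot `f`, so all cars ending beyond `f` also prefer
      -- spots beyond it. They include one in each of the `n - f` spots up to `n`, and `z` in
      -- addition.
      over-gap : ∀ {f} → f < n → ¬ Taken f → (∀ {x} → f < x → x ≤ n → Taken x) →
        ∀ z → n < lookup ss z → Over α f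
      over-gap {f} f<n ¬Tf filled z n<sz = f<n , (begin
        suc n                                  ≡⟨ cong suc (sym n≡) ⟩
        suc (n ∸ f + f)                        ≡⟨ cong suc (+-comm (n ∸ f) f) ⟩
        suc (f + (n ∸ f))                      ≡⟨ sym (+-suc f (n ∸ f)) ⟩
        f + suc (n ∸ f)                        ≡⟨ cong (f +_) (+-comm 1 (n ∸ f)) ⟩
        f + (n ∸ f + 1)                        ≤⟨ +-monoʳ-≤ f (+-monoʳ-≤ (n ∸ f) beyond) ⟩
        f + (n ∸ f + atLeast (suc (n ∸ f) + f) ss)  ≤⟨ +-monoʳ-≤ f (atLeast-filled ss (n ∸ f) f
                                                  (λ f<x x≤ → filled f<x (≤-trans x≤ (≤-reflexive n≡)))) ⟩
        f + atLeast (suc f) ss                 ≤⟨ +-monoʳ-≤ f (count-mono (suc f ≤?_) (suc f ≤?_) ss α ss⇒α) ⟩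
        f + atLeast (suc f) α                  ∎)
        where
        open ≤-Reasoning
        n≡ : n ∸ f + f ≡ n
        n≡ = m∸n+n≡m (<⇒≤ f<n)
        beyond : 1 ≤ atLeast (suc (n ∸ f) + f) ss
        beyond = count-positive (suc (n ∸ f) + f ≤?_) ss z (≤-trans (≤-reflexive (cong suc n≡)) n<sz)
        ss⇒α : ∀ i → suc f ≤ lookup ss i → suc f ≤ lookup α i
        ss⇒α i f<s = ≰⇒> λ a≤f → ¬Tf (taken i (≤-trans (proj₁ (lookup⁺ α∈ i)) a≤f) a≤f f<s)

      -- f is the last free spot and w + 1 is the spot just before the interval
      -- of U α that contains f + 1.
      gap-contradiction : ∀ {f w q} → w < f → suc f ≤ q → MaximalInterval (suc (suc w)) q (U α) →
        ¬ suc w ∈ U α → ¬ Taken f → ⊥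
      gap-contradiction {f} {w} {q} w<f f<q mi ¬U-w ¬Tf
        with J , J-prefs , cβ , (β∈ , ap) ← blocks (suc (suc w)) q mi
        with tt , rβ , tt≤m ← AllPark⇒Run β∈ ap = result
        where
        open MaximalInterval mi
        open ≤-Reasoning
        m = ∣ J ∣
        β = τ w (restrict α J)
        f<w+m : f < w + m
        -- Otherwise `suc (w + m)` is still in the interval. The `m` cars of `J` prefer spots from
        -- `suc w` to `w + m`, and adding them to the tail would put `suc w` in `U α`.
        f<w+m = ≰⇒> λ w+m≤f →
          let u : suc (w + m) ∈ U α
              u = included (s≤s (≤-trans (≤-reflexive (+-comm 1 w)) (+-monoʳ-≤ w (≤-trans (s≤s z≤n) (Complete.length≥2 cβ)))) ,
                            ≤-trans (s≤s w+m≤f) f<q)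
              w+m<n , n< = U⇒Over α α≤n u
          in ¬U-w (Over⇒U α α≤n (≤-<-trans (m≤m+n w m) w+m<n , (begin-strict
            n                                      <⟨ n< ⟩
            w + m + atLeast (suc (w + m)) α        ≡⟨ +-assoc w m _ ⟩
            w + (m + atLeast (suc (w + m)) α)      ≤⟨ +-monoʳ-≤ w (∣J∣+atLeast≤ J α (s≤s (m≤m+n w m))
                                                       (λ j j∈ → <⇒≤ (proj₁ (J-prefs j j∈)) , s≤s (proj₂ (J-prefs j j∈)))) ⟩
            w + atLeast (suc w) α                  ∎)))
        f≡ : f ∸ w + w ≡ f
        f≡ = m∸n+n≡m (<⇒≤ w<f)
        1≤f′ : 1 ≤ f ∸ w
        1≤f′ = m<n⇒0<n∸m w<f
        f′<m : f ∸ w < m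
        f′<m = +-cancelʳ-< w _ _ (≤-<-trans (≤-reflexive f≡) (<-≤-trans f<w+m (≤-reflexive (+-comm w m))))
        result : ⊥
        result =
          -- In the run of `β`, `x` takes the spot of `f` and, by completeness, `y` crosses backward
          -- to that spot or beyond it. Hence `x` does not come from the left, which
          -- `Run-restrict-fills` excludes.
          let x , tx≡ = Run-surjective rβ tt≤m 1≤f′ (<⇒≤ f′<m)
              y , f<b , t≤f = Run-crossing rβ tt≤m
                (U⇒Over β (proj₂ ∘ lookup⁺ β∈) (proj₂ (Complete.U≐[2,n] cβ) (s≤s 1≤f′ , f′<m)))
          in Run-restrict-fills 1≤f′ r J (λ j j∈ → ≤-trans (n≤1+n w) (<⇒≤ (proj₁ (J-prefs j j∈)))) rβ
            (λ ()) (λ ()) (λ j sj≡ → ¬Tf (j , trans sj≡ f≡)) (λ _ ()) x tx≡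
            (≮⇒≥ λ b<f → no-crossing rβ x y (<-≤-trans b<f (≤-reflexive (sym tx≡)))
              (≤-trans (≤-reflexive tx≡) (<⇒≤ f<b)) (≤-trans t≤f (≤-reflexive (sym tx≡))))

    blocks⇒≤n : ∀ i → lookup ss i ≤ n
    blocks⇒≤n z = ≮⇒≥ overflow
      where
      overflow : ¬ n < lookup ss z
      overflow n<sz
        -- Spot `n` is taken because `z` passed over it. The search downward may end at `f = 0`;
        -- this case is refuted below, since it would put 1 in `U α`.
        with f , f<n , filled , ¬Tf ← first-to Taken?
               (λ { (i , s≡0) → <⇒≱ (Run-positive r i) (≤-reflexive s≡0) })
               (taken z (≤-trans (proj₁ (lookup⁺ α∈ z)) (α≤n z)) (α≤n z) n<sz)
        with u ← Over⇒U α α≤n (over-gap f<n ¬Tf filled z n<sz)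
        with first-to (U? α α≤n) (λ { ((() , _) , _) }) u
           | last-before (U? α α≤n) {r = suc n} u (λ { ((_ , n<n) , _) → <⇒≱ n<n ≤-refl }) (s≤s (<⇒≤ f<n))
      ... | zero , p≤f , inU , ¬Up | _ =
        ¬Over-zero α (U⇒Over α α≤n (inU ≤-refl (s≤s z≤n)))
      ... | suc w , w<f , inU , ¬Up | q , f<q , inU′ , ¬Uq =
        gap-contradiction (s≤s⁻¹ w<f) f<q mi ¬Up ¬Tf
        where
        mi : MaximalInterval (suc (suc w)) q (U α)
        mi = record
          { nonempty = ≤-trans w<f f<q
          ; included = λ {x} (p≤x , x≤q) → included p≤x x≤q (x ≤? suc f)
          ; maximal  = λ p′ q′ ⊇ ⊆U {x} (p′≤x , x≤q′) →
              let p′≤p , _ = ⊇ (≤-refl , ≤-trans w<f f<q)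
                  _ , q≤q′ = ⊇ (≤-trans w<f f<q , ≤-refl)
              in ≰⇒> (λ x≤w → ¬Up (⊆U (≤-trans p′≤x x≤w , ≤-trans (<⇒≤ (≤-trans w<f f<q)) q≤q′))) ,
                 ≮⇒≥ (λ q<x → ¬Uq (⊆U (≤-trans p′≤p (m≤n⇒m≤1+n (≤-trans w<f f<q)) , ≤-trans q<x x≤q′)))
          }
          where
          included : ∀ {x} → suc w < x → x ≤ q → Dec (x ≤ suc f) → x ∈ U α
          included p≤x _   (yes x≤f) = inU p≤x x≤f
          included _   x≤q (no x≰f)  = inU′ (<⇒≤ (≰⇒> x≰f)) x≤q

theorem4p1 : (n k : ℕ) → 1 ≤ n → (α : Vec ℕ n) → PP α →
    PF k α ⇔
    ((p q : ℕ) → MaximalInterval p q (U α) →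
    ∃ λ (J : Subset n) →
    ((j : Fin n) → j ∈ˢ J → lookup α j ∈ [ p , (p ∸ 2) + ∣ J ∣ ]) ×
    Complete (τ (p ∸ 2) (restrict α J)) ×
    PF k (τ (p ∸ 2) (restrict α J)))
theorem4p1 n k _ α α∈ = mk⇔ (PF⇒blocks α∈) λ blocks →
  let ss , r = Run-exists k [] (All.map proj₁ α∈)
  in α∈ , Run⇒AllPark α∈ r (blocks⇒≤n α∈ blocks r)
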